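{- Let $V$ be a model of ZFC, let $\mathcal{G}$ be a $V$-generic filter for $\mathbb{P}$, and work in $V[\mathcal{G}]$. The first projection $\pi_1:\omega^2\to\omega$, $\pi_1(\langle n,m\rangle)=n$, is not finite-to-one or constant on any set in $\mathcal{G}$. Thus, $\mathcal{G}$ is not a P-point.
   Context: For $p\subseteq\omega^2$, $p(n)=\{m:\langle n,m\rangle\in p\}$. $\mathcal{F}$ is the Fréchet filter on $\omega$, and $\mathcal{F}^{\otimes 2}$ is the filter of all $X\subseteq\omega^2$ such that $X(n)$ is cofinite for all but finitely many $n$. The forcing $\mathbb{P}=(\mathcal{F}^{\otimes 2})^+$ consists of the sets $p\subseteq\omega^2$ such that $p(n)$ is infinite for infinitely many $n$, ordered by inclusion. A $V$-generic filter for $\mathbb{P}$ is an ultrafilter on $\omega^2$ in the extension. An ultrafilter $\mathcal{W}$ on a countable set $S$ is a P-point if for every $f:S\to\omega$ there is $A\in\mathcal{W}$ on which $f$ is finite-to-one or constant. -}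

module Defs where

open import Data.Bool.Base using (Bool; true; false)
open import Data.Empty.Polymorphic using (⊥)
open import Data.Fin.Base using (Fin)
open import Data.Maybe.Base using (Maybe; just; nothing)
open import Data.Nat.Base using (ℕ; zero; suc)
open import Data.Product.Base using (Σ; ∃; _×_; _,_; proj₁)
open import Data.Sum.Base using (_⊎_)
open import Data.Vec.Base using (Vec; _∷_; lookup)
open import Data.Vec.Relation.Unary.All using (All)
open import Function.Base using (_∘_)
open import Function.Bundles using (_⇔_)
open import Level using (Level; Lift; lift; lower; _⊔_) renaming (suc to lsuc)
open import Relation.Nullary.Negation.Core using (¬_; DoubleNegation; Stable)
open import Relation.Unary using (Pred)

private variable
  a b c ℓ : Level

------------------------------------------------------------------------
-- Classical logic.  ZFC is a classical theory, so throughout "there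
-- exists" and "or" are read through the double-negation translation,
-- including inside the equality and membership of sets.  Assuming
-- excluded middle they are equivalent to the plain Σ and ⊎.

∃ᶜ : {A : Set a} → (A → Set b) → Set (a ⊔ b)
∃ᶜ P = DoubleNegation (∃ P)

infixr 1 _∨ᶜ_
_∨ᶜ_ : Set a → Set b → Set (a ⊔ b)
P ∨ᶜ Q = DoubleNegation (P ⊎ Q)

------------------------------------------------------------------------
-- The ambient universe of sets: Aczel's cumulative hierarchy, with
-- extensional equality _≈_.

data 𝕍 (ℓ : Level) : Set (lsuc ℓ) where
  sup : (I : Set ℓ) → (I → 𝕍 ℓ) → 𝕍 ℓ

idx : 𝕍 ℓ → Set ℓ
idx (sup I f) = I

el : (x : 𝕍 ℓ) → idx x → 𝕍 ℓ
el (sup I f) = f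

infix 4 _≈_ _∈_ _⊆_

_≈_ : 𝕍 ℓ → 𝕍 ℓ → Set ℓ
sup I f ≈ sup J g =
  (∀ i → ∃ᶜ λ j → f i ≈ g j) × (∀ j → ∃ᶜ λ i → f i ≈ g j)

_∈_ : 𝕍 ℓ → 𝕍 ℓ → Set ℓ
x ∈ y = ∃ᶜ λ i → x ≈ el y i

_⊆_ : 𝕍 ℓ → 𝕍 ℓ → Set (lsuc ℓ)
x ⊆ y = ∀ z → z ∈ x → z ∈ y

∅ : 𝕍 ℓ
∅ = sup ⊥ λ ()

-- {x, y}
pair : 𝕍 ℓ → 𝕍 ℓ → 𝕍 ℓ
pair x y = sup (Lift _ Bool) λ where
  (lift true)  → x
  (lift false) → y

-- The Kuratowski ordered pair {{x}, {x, y}}.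
⟪_,_⟫ : 𝕍 ℓ → 𝕍 ℓ → 𝕍 ℓ
⟪ x , y ⟫ = pair (pair x x) (pair x y)

-- {x ∈ A : P x}
sep : 𝕍 ℓ → (𝕍 ℓ → Set ℓ) → 𝕍 ℓ
sep A P = sup (Σ (idx A) (P ∘ el A)) (el A ∘ proj₁)

infixr 7 _∩_
_∩_ : 𝕍 ℓ → 𝕍 ℓ → 𝕍 ℓ
X ∩ Y = sep X (_∈ Y)

infixr 6 _∖_
_∖_ : 𝕍 ℓ → 𝕍 ℓ → 𝕍 ℓ
X ∖ Y = sep X λ x → ¬ (x ∈ Y)

infixr 8 _⊗_
_⊗_ : 𝕍 ℓ → 𝕍 ℓ → 𝕍 ℓ
A ⊗ B = sup (idx A × idx B) λ (i , j) → ⟪ el A i , el B j ⟫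

-- x ∪ {x}
succ : 𝕍 ℓ → 𝕍 ℓ
succ x = sup (Maybe (idx x)) λ where
  (just i) → el x i
  nothing  → x

num : ℕ → 𝕍 ℓ
num zero    = ∅
num (suc n) = succ (num n)

ω : 𝕍 ℓ
ω = sup (Lift _ ℕ) (num ∘ lower)

ω² : 𝕍 ℓ
ω² = ω ⊗ ω

-- The first projection ω² → ω, as a set of pairs ⟨⟨n,m⟩,n⟩.
π₁ : 𝕍 ℓ
π₁ = sup (idx ω × idx ω) λ (i , j) → ⟪ ⟪ el ω i , el ω j ⟫ , el ω i ⟫

-- p(n) = {m : ⟨n,m⟩ ∈ p}
section : 𝕍 ℓ → 𝕍 ℓ → 𝕍 ℓ
section p n = sep ω λ m → ⟪ n , m ⟫ ∈ p

-- {x ∈ A : f(x) = k}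
fibre : 𝕍 ℓ → 𝕍 ℓ → 𝕍 ℓ → 𝕍 ℓ
fibre f A k = sep A λ x → ⟪ x , k ⟫ ∈ f

-- f : S → ω is constant on A ⊆ S.
ConstantOn : (f A : 𝕍 ℓ) → Set (lsuc ℓ)
ConstantOn f A = ∃ᶜ λ k → k ∈ ω × (∀ x → x ∈ A → ⟪ x , k ⟫ ∈ f)

record IsFunction (f A B : 𝕍 ℓ) : Set (lsuc ℓ) where
  field
    graph      : f ⊆ A ⊗ B
    total      : ∀ x → x ∈ A → ∃ᶜ λ y → ⟪ x , y ⟫ ∈ f
    functional : ∀ x y z → ⟪ x , y ⟫ ∈ f → ⟪ x , z ⟫ ∈ f → y ≈ z

record IsBijection (f A B : 𝕍 ℓ) : Set (lsuc ℓ) where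
  field
    isFunction : IsFunction f A B
    injective  : ∀ x y z → ⟪ x , z ⟫ ∈ f → ⟪ y , z ⟫ ∈ f → x ≈ y
    surjective : ∀ y → y ∈ B → ∃ᶜ λ x → ⟪ x , y ⟫ ∈ f

------------------------------------------------------------------------
-- First-order formulas of the language {∈, =}, with n free variables
-- (de Bruijn indices), and their truth in a class M.

infix  8 _∈̇_ _≐_
infixr 7 _∧̇_
infixr 6 _∨̇_
infixr 5 _⇒̇_

data Formula (n : ℕ) : Set where
  _∈̇_ _≐_        : Fin n → Fin n → Formula n
  ⊥̇              : Formula n
  _∧̇_ _∨̇_ _⇒̇_ : Formula n → Formula n → Formula n
  ∀̇_ ∃̇_         : Formula (suc n) → Formula n

infix 4 _⊨_[_]
_⊨_[_] : ∀ {n} → Pred (𝕍 ℓ) c → Formula n → Vec (𝕍 ℓ) n → Set (lsuc ℓ ⊔ c)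
_⊨_[_] {ℓ} {c} M (i ∈̇ j) ρ = Lift (lsuc ℓ ⊔ c) (lookup ρ i ∈ lookup ρ j)
_⊨_[_] {ℓ} {c} M (i ≐ j) ρ = Lift (lsuc ℓ ⊔ c) (lookup ρ i ≈ lookup ρ j)
M ⊨ ⊥̇     [ ρ ] = ⊥
M ⊨ φ ∧̇ ψ [ ρ ] = (M ⊨ φ [ ρ ]) × (M ⊨ ψ [ ρ ])
M ⊨ φ ∨̇ ψ [ ρ ] = (M ⊨ φ [ ρ ]) ∨ᶜ (M ⊨ ψ [ ρ ])
M ⊨ φ ⇒̇ ψ [ ρ ] = M ⊨ φ [ ρ ] → M ⊨ ψ [ ρ ]
M ⊨ ∀̇ φ   [ ρ ] = ∀ x → M x → M ⊨ φ [ x ∷ ρ ]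
M ⊨ ∃̇ φ   [ ρ ] = ∃ᶜ λ x → M x × (M ⊨ φ [ x ∷ ρ ])

------------------------------------------------------------------------
-- Notions relativised to a class M

module _ {ℓ c : Level} (M : Pred (𝕍 ℓ) c) where

  private
    ∀ᴹ : (𝕍 ℓ → Set a) → Set (lsuc ℓ ⊔ c ⊔ a)
    ∀ᴹ P = ∀ x → M x → P x

    ∃ᴹ : (𝕍 ℓ → Set a) → Set (lsuc ℓ ⊔ c ⊔ a)
    ∃ᴹ P = ∃ᶜ λ x → M x × P x

  -- (M, ∈) satisfies the axioms of ZFC.
  record IsZFC : Set (lsuc ℓ ⊔ c) where
    field
      extensionality : ∀ᴹ λ x → ∀ᴹ λ y → (∀ᴹ λ z → z ∈ x ⇔ z ∈ y) → x ≈ y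

      pairing : ∀ᴹ λ x → ∀ᴹ λ y → ∃ᴹ λ z → ∀ᴹ λ w → w ∈ z ⇔ (w ≈ x ∨ᶜ w ≈ y)

      union : ∀ᴹ λ x → ∃ᴹ λ u → ∀ᴹ λ z → z ∈ u ⇔ (∃ᴹ λ y → y ∈ x × z ∈ y)

      powerSet : ∀ᴹ λ x → ∃ᴹ λ p → ∀ᴹ λ y →
        y ∈ p ⇔ (∀ᴹ λ z → z ∈ y → z ∈ x)

      infinity : ∃ᴹ λ x →
        (∃ᴹ λ e → e ∈ x × ∀ᴹ λ z → ¬ (z ∈ e)) ×
        (∀ᴹ λ y → y ∈ x → ∃ᴹ λ s → s ∈ x × ∀ᴹ λ z → z ∈ s ⇔ (z ∈ y ∨ᶜ z ≈ y))

      foundation : ∀ᴹ λ x → (∃ᴹ λ y → y ∈ x) →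
        ∃ᴹ λ y → y ∈ x × ∀ᴹ λ z → z ∈ y → ¬ (z ∈ x)

      separation : ∀ {n} (φ : Formula (suc n)) ρ → All M ρ →
        ∀ᴹ λ x → ∃ᴹ λ y → ∀ᴹ λ z → z ∈ y ⇔ (z ∈ x × (M ⊨ φ [ z ∷ ρ ]))

      replacement : ∀ {n} (φ : Formula (suc (suc n))) ρ → All M ρ →
        (∀ᴹ λ x → ∀ᴹ λ y → ∀ᴹ λ z →
          M ⊨ φ [ x ∷ y ∷ ρ ] → M ⊨ φ [ x ∷ z ∷ ρ ] → y ≈ z) →
        ∀ᴹ λ X → ∃ᴹ λ Y → ∀ᴹ λ y →
          y ∈ Y ⇔ (∃ᴹ λ x → x ∈ X × (M ⊨ φ [ x ∷ y ∷ ρ ]))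

      -- Every family of nonempty, pairwise disjoint sets has a transversal.
      choice : ∀ᴹ λ F →
        (∀ᴹ λ x → x ∈ F → ∃ᴹ λ z → z ∈ x) →
        (∀ᴹ λ x → ∀ᴹ λ y → x ∈ F → y ∈ F →
          (∃ᴹ λ z → z ∈ x × z ∈ y) → x ≈ y) →
        ∃ᴹ λ C → ∀ᴹ λ x → x ∈ F →
          ∃ᴹ λ z → (z ∈ x × z ∈ C) × (∀ᴹ λ w → w ∈ x → w ∈ C → w ≈ z)

  -- A transitive (set or proper class) model of ZFC.  Stability says that
  -- membership in the class is a classical proposition; invariance under _≈_
  -- follows from transitivity and pairing.
  record IsTransitiveModel : Set (lsuc ℓ ⊔ c) where
    field
      stable     : ∀ x → Stable (M x)
      transitive : ∀ x y → x ∈ y → M y → M x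
      isZFC      : IsZFC

  -- In the following, M is meant to be a transitive model.  Pairs, ω, ω²,
  -- "f is a bijection from A to B", etc. are absolute for M and are not
  -- relativised; quantifiers over arbitrary functions and subsets are.

  Finite : 𝕍 ℓ → Set (lsuc ℓ ⊔ c)
  Finite x = ∃ᶜ λ k → k ∈ ω × (∃ᴹ λ f → IsBijection f k x)

  Infinite : 𝕍 ℓ → Set (lsuc ℓ ⊔ c)
  Infinite x = ¬ Finite x

  -- The set {n ∈ ω : Q n}, formed in M, is infinite.
  InfinitelyMany : (𝕍 ℓ → Set a) → Set (lsuc ℓ ⊔ c ⊔ a)
  InfinitelyMany Q =
    ∃ᴹ λ D → (D ⊆ ω × (∀ n → n ∈ ω → n ∈ D ⇔ Q n)) × Infinite D

  -- The forcing notion of M, ordered by _⊆_.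
  ℙ : 𝕍 ℓ → Set (lsuc ℓ ⊔ c)
  ℙ p = M p × p ⊆ ω² × InfinitelyMany λ n → Infinite (section p n)

  Dense : 𝕍 ℓ → Set (lsuc ℓ ⊔ c)
  Dense D = (∀ p → p ∈ D → ℙ p) × (∀ p → ℙ p → ∃ᶜ λ q → q ∈ D × q ⊆ p)

  -- G is an M-generic filter on ℙ; G need not belong to M.
  record IsGenericFilter (G : 𝕍 ℓ) : Set (lsuc ℓ ⊔ c) where
    field
      conditions : ∀ p → p ∈ G → ℙ p
      nonempty   : ∃ᶜ λ p → p ∈ G
      upward     : ∀ p q → p ∈ G → ℙ q → p ⊆ q → q ∈ G
      directed   : ∀ p q → p ∈ G → q ∈ G → ∃ᶜ λ r → r ∈ G × r ⊆ p × r ⊆ q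
      generic    : ∀ D → M D → Dense D → ∃ᶜ λ p → p ∈ D × p ∈ G

  record IsUltrafilter (S W : 𝕍 ℓ) : Set (lsuc ℓ ⊔ c) where
    field
      subsets : ∀ X → X ∈ W → X ⊆ S
      whole   : S ∈ W
      proper  : ¬ (∅ ∈ W)
      upward  : ∀ X Y → X ∈ W → M Y → X ⊆ Y → Y ⊆ S → Y ∈ W
      meets   : ∀ X Y → X ∈ W → Y ∈ W → X ∩ Y ∈ W
      ultra   : ∀ X → M X → X ⊆ S → X ∈ W ∨ᶜ S ∖ X ∈ W

  FiniteToOneOn : (f A : 𝕍 ℓ) → Set (lsuc ℓ ⊔ c)
  FiniteToOneOn f A = ∀ k → k ∈ ω → Finite (fibre f A k)

  record IsPPoint (S W : 𝕍 ℓ) : Set (lsuc ℓ ⊔ c) where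
    field
      isUltrafilter : IsUltrafilter S W
      pPoint : ∀ f → M f → IsFunction f S ω →
        ∃ᶜ λ A → A ∈ W × (FiniteToOneOn f A ∨ᶜ ConstantOn f A)

------------------------------------------------------------------------
-- The generic extension.  As in Shoenfield's presentation every set is
-- treated as a name, elements that are not pairs being ignored:
--   val G τ = {val G σ : ⟨σ,p⟩ ∈ τ for some p ∈ G}.
-- If ⟨σ,p⟩ ∈ τ then σ is, up to _≈_, an element of an element of an
-- element of τ; val searches for it there to recurse on the tree τ.

mutual
  val : 𝕍 ℓ → 𝕍 ℓ → 𝕍 ℓ
  val G (sup I f) = sup (Σ I λ i → Coded G (f i)) λ (i , s) → valCoded G (f i) s

  -- The ways in which x is a pair ⟨σ,p⟩ with p ∈ G.
  Coded : 𝕍 ℓ → 𝕍 ℓ → Set _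
  Coded G x = Σ (idx x) λ j → Σ (idx (el x j)) λ k →
    Σ (idx G) λ g → x ≈ ⟪ el (el x j) k , el G g ⟫

  -- val of the first component of x
  valCoded : (G x : 𝕍 ℓ) → Coded G x → 𝕍 ℓ
  valCoded G (sup J h) (j , k , _) = valAt G (h j) k

  valAt : (G y : 𝕍 ℓ) → idx y → 𝕍 ℓ
  valAt G (sup K h) k = val G (h k)

infix 20 _[_]
_[_] : Pred (𝕍 ℓ) c → 𝕍 ℓ → Pred (𝕍 ℓ) (lsuc ℓ ⊔ c)
(M [ G ]) x = ∃ᶜ λ τ → M τ × x ≈ val G τ

{-# OPTIONS --safe #-}
module Submission where

-- If A is a condition, then infinitely many sections A(n) are infinite in V.
-- So A meets more than one fibre of π₁.  And a fibre that is finite in V[G] is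
-- finite outside the models, so its elements can be collected into V one by
-- one and the section is finite in V.  Thus π₁ is neither constant nor
-- finite-to-one on A.  For the failure of the P-point property, π₁ must
-- moreover be shown to lie in V[G], which takes a name for it in V: the names
-- of the natural numbers form a set of V by recursion on ω, and the name of
-- π₁ arises from that set by images, pairs and unions.

open import Defs
open import Data.Bool.Base using (true; false)
open import Data.Fin.Base as Fin using (Fin; suc)
open import Data.Fin.Patterns
open import Data.Maybe.Base using (just; nothing)
open import Data.Nat.Base using (ℕ; zero; suc; _<_; z≤n; s≤s)
open import Data.Nat.Properties using (≰⇒>; m<n⇒m<1+n; m<1+n⇒m<n∨m≡n; <-cmp; n<1+n)
open import Data.Product.Base using (Σ; ∃; _×_; _,_; proj₁; proj₂)
open import Data.Sum.Base using (_⊎_; inj₁; inj₂; [_,_]′)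
open import Data.Vec.Base using (Vec; []; _∷_; lookup)
open import Data.Vec.Relation.Unary.All using (All; []; _∷_)
open import Data.Vec.Relation.Unary.All.Properties using (lookup⁺)
open import Function.Base using (_∘_)
open import Function.Bundles using (_⇔_; mk⇔; Equivalence)
open import Level using (Level; Lift; lift; lower; _⊔_) renaming (suc to lsuc)
open import Relation.Binary.Definitions using (tri<; tri≈; tri>)
open import Relation.Binary.PropositionalEquality using (_≡_; refl; sym; subst)
open import Relation.Nullary.Decidable.Core using (yes; no; ¬¬-excluded-middle)
open import Relation.Nullary.Negation.Core using (¬_; Stable; contradiction)
open import Relation.Unary using (Pred)

open Equivalence using (to; from)

private variable
  a b c ℓ : Level
  A B : Set a
  w x y z x′ y′ z′ : 𝕍 ℓ

-- The double-negation monad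

infixl 1 _>>=_
-- Classical existence, disjunction and membership are all double negations, so they can be proved
-- in `do` blocks.
_>>=_ : ¬ ¬ A → (A → ¬ ¬ B) → ¬ ¬ B
(m >>= f) k = m λ x → f x k

return : A → ¬ ¬ A
return x k = k x

-- Extensional equality and membership

≈-refl : x ≈ x
≈-refl {x = sup I f} = (λ i → return (i , ≈-refl)) , (λ i → return (i , ≈-refl))

≈-sym : x ≈ y → y ≈ x
≈-sym {x = sup I f} {y = sup J g} (p , q) =
  (λ j → do i , e ← q j ; return (i , ≈-sym e)) ,
  (λ i → do j , e ← p i ; return (j , ≈-sym e))

≈-trans : x ≈ y → y ≈ z → x ≈ z
≈-trans {x = sup I f} {y = sup J g} {z = sup K h} (p , q) (r , s) =
  (λ i → do j , e ← p i ; k , d ← r j ; return (k , ≈-trans e d)) ,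
  (λ k → do j , d ← s k ; i , e ← q j ; return (i , ≈-trans e d))

-- Both halves of an equality end in a double negation. Hence equalities, too, may be proved inside
-- the monad.
≈-stable : Stable (x ≈ y)
≈-stable {x = sup I f} {y = sup J g} m =
  (λ i → m >>= λ e → proj₁ e i) , (λ j → m >>= λ e → proj₂ e j)

el∈ : (x : 𝕍 ℓ) (i : idx x) → el x i ∈ x
el∈ x i = return (i , ≈-refl)

∈-respˡ : ∀ z → x ≈ y → x ∈ z → y ∈ z
∈-respˡ z e p = do i , d ← p ; return (i , ≈-trans (≈-sym e) d)

∈-respʳ : y ≈ z → x ∈ y → x ∈ z
∈-respʳ {y = sup I f} {z = sup J g} (p , q) x∈y = do
  i , e ← x∈y
  j , d ← p i
  return (j , ≈-trans e d)

≈-ext : x ⊆ y → y ⊆ x → x ≈ y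
≈-ext {x = sup I f} {y = sup J g} p q =
  (λ i → p (f i) (el∈ (sup I f) i)) ,
  (λ j → do i , e ← q (g j) (el∈ (sup J g) j) ; return (i , ≈-sym e))

-- If `x ≈ f i`, then `x ∈ x` carries over to `f i ∈ f i`, and `f i` is a smaller tree.
∈-irrefl : (x : 𝕍 ℓ) → ¬ (x ∈ x)
∈-irrefl x@(sup I f) x∈x = x∈x λ (i , e) →
  ∈-irrefl (f i) (∈-respʳ e (∈-respˡ x e x∈x))

∉∅ : (z : 𝕍 ℓ) → ¬ (z ∈ ∅)
∉∅ z z∈∅ = z∈∅ λ ()

∈pairˡ : (x y : 𝕍 ℓ) → x ∈ pair x y
∈pairˡ x y = el∈ (pair x y) (lift true)

∈pairʳ : (x y : 𝕍 ℓ) → y ∈ pair x y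
∈pairʳ x y = el∈ (pair x y) (lift false)

∈pair⁻ : z ∈ pair x y → z ≈ x ∨ᶜ z ≈ y
∈pair⁻ z∈ = z∈ >>= λ where
  (lift true  , e) → return (inj₁ e)
  (lift false , e) → return (inj₂ e)

∈singleton⁻ : z ∈ pair x x → z ≈ x
∈singleton⁻ z∈ = ≈-stable (∈pair⁻ z∈ >>= [ return , return ]′)

pair-cong : x ≈ x′ → y ≈ y′ → pair x y ≈ pair x′ y′
pair-cong d e =
  (λ { (lift true) → return (lift true , d) ; (lift false) → return (lift false , e) }) ,
  (λ { (lift true) → return (lift true , d) ; (lift false) → return (lift false , e) })

⟪⟫-cong : x ≈ x′ → y ≈ y′ → ⟪ x , y ⟫ ≈ ⟪ x′ , y′ ⟫
⟪⟫-cong d e = pair-cong (pair-cong d d) (pair-cong d e)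

-- `pair x x` equals `pair x′ x′` or `pair x′ y′`, and in both cases `x′` is a member of it.
⟪⟫-injectiveˡ : ⟪ x , y ⟫ ≈ ⟪ x′ , y′ ⟫ → x ≈ x′
⟪⟫-injectiveˡ {x = x} {y} {x′} {y′} e = ≈-stable do
  d ← ∈pair⁻ (∈-respʳ {y = ⟪ x , y ⟫} {z = ⟪ x′ , y′ ⟫} e (∈pairˡ (pair x x) (pair x y)))
  return (≈-sym (∈singleton⁻ ([ (λ d → ∈-respʳ (≈-sym d) (∈pairˡ x′ x′))
                              , (λ d → ∈-respʳ (≈-sym d) (∈pairˡ x′ y′)) ]′ d)))

⟪⟫-second : ⟪ x , y ⟫ ≈ ⟪ x′ , y′ ⟫ → y ≈ x′ ∨ᶜ y ≈ y′
⟪⟫-second {x = x} {y} {x′} {y′} e =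
  ∈pair⁻ (∈-respʳ {y = ⟪ x , y ⟫} {z = ⟪ x′ , y′ ⟫} e (∈pairʳ (pair x x) (pair x y))) >>=
  [ (λ d → return (inj₁ (∈singleton⁻ (∈-respʳ d (∈pairʳ x y)))))
  , (λ d → ∈pair⁻ (∈-respʳ d (∈pairʳ x y))) ]′

⟪⟫-injectiveʳ : ⟪ x , y ⟫ ≈ ⟪ x′ , y′ ⟫ → y ≈ y′
⟪⟫-injectiveʳ {x = x} {y} {x′} {y′} e = ≈-stable (⟪⟫-second e >>= [ degenerate , return ]′)
  where
  -- The reverse comparison gives `y′ ≈ x` or `y′ ≈ y`; in the first case all four components
  -- coincide.
  degenerate : y ≈ x′ → ¬ ¬ (y ≈ y′)
  degenerate d = ⟪⟫-second (≈-sym e) >>=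
    [ (λ f → return (≈-trans d (≈-trans (≈-sym (⟪⟫-injectiveˡ e)) (≈-sym f))))
    , (λ f → return (≈-sym f)) ]′

succ-⊆ : (x : 𝕍 ℓ) → x ⊆ succ x
succ-⊆ x z z∈x = do i , e ← z∈x ; return (just i , e)

∈succ : (x : 𝕍 ℓ) → x ∈ succ x
∈succ x = el∈ (succ x) nothing

∈succ⁻ : z ∈ succ x → z ∈ x ∨ᶜ z ≈ x
∈succ⁻ z∈ = z∈ >>= λ where
  (just i  , e) → return (inj₁ (return (i , e)))
  (nothing , e) → return (inj₂ e)

⋃ : 𝕍 ℓ → 𝕍 ℓ
⋃ x = sup (Σ (idx x) (idx ∘ el x)) λ (i , j) → el (el x i) j

∈⋃ : ∀ x → y ∈ x → z ∈ y → z ∈ ⋃ x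
∈⋃ x y∈x z∈y = do
  i , e ← y∈x
  j , d ← ∈-respʳ e z∈y
  return ((i , j) , d)

∈⋃⁻ : ∀ x → z ∈ ⋃ x → ∃ᶜ λ y → y ∈ x × z ∈ y
∈⋃⁻ x z∈ = do
  (i , j) , e ← z∈
  return (el x i , el∈ x i , return (j , e))

⋃-cong : x ≈ y → ⋃ x ≈ ⋃ y
⋃-cong {x = x} {y} e = ≈-ext
  (λ z z∈ → do w , w∈ , z∈w ← ∈⋃⁻ x z∈ ; ∈⋃ y (∈-respʳ e w∈) z∈w)
  (λ z z∈ → do w , w∈ , z∈w ← ∈⋃⁻ y z∈ ; ∈⋃ x (∈-respʳ (≈-sym e) w∈) z∈w)

-- Built from `pair` and `⋃` alone, so that pairing and union keep it inside a model and a term can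
-- denote it.
insert : 𝕍 ℓ → 𝕍 ℓ → 𝕍 ℓ
insert x y = ⋃ (pair x (pair y y))

insert-⊆ : (x y : 𝕍 ℓ) → x ⊆ insert x y
insert-⊆ x y z = ∈⋃ (pair x (pair y y)) (∈pairˡ x (pair y y))

∈insert : (x y : 𝕍 ℓ) → y ∈ insert x y
∈insert x y = ∈⋃ (pair x (pair y y)) (∈pairʳ x (pair y y)) (∈pairˡ y y)

∈insert⁻ : ∀ x y → z ∈ insert x y → z ∈ x ∨ᶜ z ≈ y
∈insert⁻ x y z∈ = do
  w , w∈ , z∈w ← ∈⋃⁻ (pair x (pair y y)) z∈
  ∈pair⁻ w∈ >>= [ (λ e → return (inj₁ (∈-respʳ e z∈w)))
                , (λ e → return (inj₂ (∈singleton⁻ (∈-respʳ e z∈w)))) ]′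

insert-cong : x ≈ x′ → y ≈ y′ → insert x y ≈ insert x′ y′
insert-cong d e = ⋃-cong (pair-cong d (pair-cong e e))

insert≈succ : (x : 𝕍 ℓ) → insert x x ≈ succ x
insert≈succ x = ≈-ext
  (λ z z∈ → ∈insert⁻ x x z∈ >>= [ succ-⊆ x z , (λ e → ∈-respˡ (succ x) (≈-sym e) (∈succ x)) ]′)
  (λ z z∈ → ∈succ⁻ z∈ >>=
    [ insert-⊆ x x z , (λ e → ∈-respˡ (insert x x) (≈-sym e) (∈insert x x)) ]′)

image : 𝕍 ℓ → (𝕍 ℓ → 𝕍 ℓ) → 𝕍 ℓ
image x f = sup (idx x) (f ∘ el x)

image-cong : ∀ {f g} → x ≈ y → (∀ {w z} → w ≈ z → f w ≈ g z) → image x f ≈ image y g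
image-cong {x = sup I f} {y = sup J g} (p , q) h =
  (λ i → do j , e ← p i ; return (j , h e)) , (λ j → do i , e ← q j ; return (i , h e))

∈⊗ : ∀ A B → x ∈ A → y ∈ B → ⟪ x , y ⟫ ∈ A ⊗ B
∈⊗ A B x∈A y∈B = do
  i , d ← x∈A
  j , e ← y∈B
  return ((i , j) , ⟪⟫-cong d e)

∈⊗⁻ˡ : ∀ {A B : 𝕍 ℓ} → ⟪ x , y ⟫ ∈ A ⊗ B → x ∈ A
∈⊗⁻ˡ p = do (i , j) , e ← p ; return (i , ⟪⟫-injectiveˡ e)

∈⊗⁻ʳ : ∀ {A B : 𝕍 ℓ} → ⟪ x , y ⟫ ∈ A ⊗ B → y ∈ B
∈⊗⁻ʳ p = do (i , j) , e ← p ; return (j , ⟪⟫-injectiveʳ e)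

⊗-mono : ∀ (A A′ B B′ : 𝕍 ℓ) → A ⊆ A′ → B ⊆ B′ → A ⊗ B ⊆ A′ ⊗ B′
⊗-mono A A′ B B′ p q z z∈ = do
  (i , j) , e ← z∈
  ∈-respˡ (A′ ⊗ B′) (≈-sym e) (∈⊗ A′ B′ (p _ (el∈ A i)) (q _ (el∈ B j)))

∈sep⁻ : ∀ A P → z ∈ sep A P → ∃ᶜ λ w → z ≈ w × w ∈ A × P w
∈sep⁻ A P z∈ = do
  (i , p) , e ← z∈
  return (el A i , e , el∈ A i , p)

-- `P` need not respect `_≈_`, and the index found for `z` only gives a set equal to `z`; hence `P`
-- is asked for at all such sets.
∈sep : ∀ A P → (∀ {w} → z ≈ w → P w) → z ∈ A → z ∈ sep A P
∈sep A P z∈P z∈A = do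
  i , e ← z∈A
  return ((i , z∈P e) , e)

sep-⊆ : (A : 𝕍 ℓ) (P : 𝕍 ℓ → Set ℓ) → sep A P ⊆ A
sep-⊆ A P z z∈ = do
  (i , p) , e ← z∈
  return (i , e)

∈∖⁻ : (A B : 𝕍 ℓ) → z ∈ A ∖ B → ¬ (z ∈ B)
∈∖⁻ A B z∈A∖B z∈B = ∈sep⁻ A (λ x → ¬ (x ∈ B)) z∈A∖B λ (w , z≈w , _ , w∉B) →
  w∉B (∈-respˡ B z≈w z∈B)

∈∖ : (A B : 𝕍 ℓ) → z ∈ A → ¬ (z ∈ B) → z ∈ A ∖ B
∈∖ A B z∈A z∉B =
  ∈sep A (λ x → ¬ (x ∈ B)) (λ z≈w w∈B → z∉B (∈-respˡ B (≈-sym z≈w) w∈B)) z∈A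

∖-⊆ : (A B : 𝕍 ℓ) → A ∖ B ⊆ A
∖-⊆ A B = sep-⊆ A λ x → ¬ (x ∈ B)

-- The natural numbers

∈ω⁻ : x ∈ ω → ∃ᶜ λ n → x ≈ num n
∈ω⁻ x∈ω = do lift n , e ← x∈ω ; return (n , e)

num∈ω : ∀ n → num {ℓ} n ∈ ω
num∈ω n = el∈ ω (lift n)

num-< : ∀ {m n} → m < n → num {ℓ} m ∈ num n
num-< {n = suc n} m<1+n with m<1+n⇒m<n∨m≡n m<1+n
... | inj₁ m<n  = succ-⊆ (num n) _ (num-< m<n)
... | inj₂ refl = ∈succ (num n)

∈num⁻ : ∀ n → x ∈ num n → ∃ᶜ λ m → m < n × x ≈ num m
∈num⁻ zero    x∈ = contradiction x∈ (∉∅ _)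
∈num⁻ (suc n) x∈ = ∈succ⁻ x∈ >>=
  [ (λ x∈n → do m , m<n , e ← ∈num⁻ n x∈n ; return (m , m<n⇒m<1+n m<n , e))
  , (λ e → return (n , n<1+n n , e)) ]′

num-injective : ∀ {m n} → num {ℓ} m ≈ num n → m ≡ n
num-injective {m = m} {n} e with <-cmp m n
... | tri< m<n _ _ = contradiction (∈-respʳ (≈-sym e) (num-< m<n)) (∈-irrefl (num m))
... | tri≈ _ m≡n _ = m≡n
... | tri> _ _ n<m = contradiction (∈-respʳ e (num-< n<m)) (∈-irrefl (num n))

-- The first projection

∈π₁ : x ∈ ω → y ∈ ω → ⟪ ⟪ x , y ⟫ , x ⟫ ∈ π₁
∈π₁ x∈ω y∈ω = do
  i , d ← x∈ω
  j , e ← y∈ω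
  return ((i , j) , ⟪⟫-cong (⟪⟫-cong d e) d)

∈π₁⁻ : ⟪ x , y ⟫ ∈ π₁ → ∃ᶜ λ m → ∃ λ n → x ≈ ⟪ num m , num n ⟫ × y ≈ num m
∈π₁⁻ p = do
  (lift m , lift n) , e ← p
  return (m , n , ⟪⟫-injectiveˡ e , ⟪⟫-injectiveʳ e)

∈π₁⁻-first : ⟪ ⟪ x , y ⟫ , z ⟫ ∈ π₁ → x ≈ z
∈π₁⁻-first p = ≈-stable do
  _ , _ , e , d ← ∈π₁⁻ p
  return (≈-trans (⟪⟫-injectiveˡ e) (≈-sym d))

π₁-isFunction : IsFunction {ℓ} π₁ ω² ω
π₁-isFunction = record
  { graph = λ z z∈ → do
      (i , j) , e ← z∈
      ∈-respˡ (ω² ⊗ ω) (≈-sym e) (∈⊗ ω² ω (∈⊗ ω ω (el∈ ω i) (el∈ ω j)) (el∈ ω i))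
  ; total = λ x x∈ → do
      (i , j) , e ← x∈
      return (el ω i , return ((i , j) , ⟪⟫-cong e ≈-refl))
  ; functional = λ x y z p q → ≈-stable do
      _ , _ , d , e ← ∈π₁⁻ p
      _ , _ , d′ , e′ ← ∈π₁⁻ q
      return (≈-trans e (≈-trans (⟪⟫-injectiveˡ (≈-trans (≈-sym d) d′)) (≈-sym e′)))
  }

∈section⁻ : (p n : 𝕍 ℓ) → z ∈ section p n → ⟪ n , z ⟫ ∈ p
∈section⁻ p n z∈ = do
  w , e , w∈ω , q ← ∈sep⁻ ω (λ m → ⟪ n , m ⟫ ∈ p) z∈
  ∈-respˡ p (⟪⟫-cong (≈-refl {x = n}) (≈-sym e)) q

section-⊆ω : (p n : 𝕍 ℓ) → section p n ⊆ ω
section-⊆ω p n = sep-⊆ ω λ m → ⟪ n , m ⟫ ∈ p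

∈fibre : (f A k : 𝕍 ℓ) → x ∈ A → ⟪ x , k ⟫ ∈ f → x ∈ fibre f A k
∈fibre f A k x∈A p =
  ∈sep A (λ x → ⟪ x , k ⟫ ∈ f) (λ e → ∈-respˡ f (⟪⟫-cong e (≈-refl {x = k})) p) x∈A

-- Terms for set operations, and formulas defining their values

-- Replacement is a scheme over formulas, so forming an image inside a model takes a syntactic
-- description of the function.
data Term (n : ℕ) : Set where
  var    : Fin n → Term n
  pairᵗ  : Term n → Term n → Term n
  ⋃ᵗ     : Term n → Term n
  imageᵗ : Term n → Term (suc n) → Term n

private variable
  m n : ℕ

⟪_,_⟫ᵗ : Term n → Term n → Term n
⟪ s , t ⟫ᵗ = pairᵗ (pairᵗ s s) (pairᵗ s t)

insertᵗ : Term n → Term n → Term n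
insertᵗ s t = ⋃ᵗ (pairᵗ s (pairᵗ t t))

-- imageᵗ s t denotes {t(x) : x ∈ s}, variable 0 of t being x.
⟦_⟧ : Term n → Vec (𝕍 ℓ) n → 𝕍 ℓ
⟦ var i ⟧      η = lookup η i
⟦ pairᵗ s t ⟧  η = pair (⟦ s ⟧ η) (⟦ t ⟧ η)
⟦ ⋃ᵗ s ⟧       η = ⋃ (⟦ s ⟧ η)
⟦ imageᵗ s t ⟧ η = image (⟦ s ⟧ η) λ x → ⟦ t ⟧ (x ∷ η)

⟦⟧-cong : (t : Term n) {η η′ : Vec (𝕍 ℓ) n} →
  (∀ i → lookup η i ≈ lookup η′ i) → ⟦ t ⟧ η ≈ ⟦ t ⟧ η′
⟦⟧-cong (var i)     e = e i
⟦⟧-cong (pairᵗ s t) e = pair-cong (⟦⟧-cong s e) (⟦⟧-cong t e)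
⟦⟧-cong (⋃ᵗ s)      e = ⋃-cong (⟦⟧-cong s e)
⟦⟧-cong (imageᵗ s t) {η} {η′} e =
  image-cong {f = λ x → ⟦ t ⟧ (x ∷ η)} {g = λ x → ⟦ t ⟧ (x ∷ η′)} (⟦⟧-cong s e) λ d → ⟦⟧-cong t λ { 0F → d ; (suc i) → e i }

∈image : (s : Term n) (t : Term (suc n)) (η : Vec (𝕍 ℓ) n) →
  x ∈ ⟦ s ⟧ η → z ≈ ⟦ t ⟧ (x ∷ η) → z ∈ ⟦ imageᵗ s t ⟧ η
∈image s t η x∈ e = do
  i , d ← x∈
  return (i , ≈-trans e (⟦⟧-cong t λ { 0F → d ; (suc k) → ≈-refl }))

mutual
  -- The variable z is a member of, resp. equals, the value of t, whose
  -- variables are renamed by σ.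
  memᶠ eqᶠ : (Fin m → Fin n) → Fin n → Term m → Formula n
  memᶠ σ z (var i)      = z ∈̇ σ i
  memᶠ σ z (pairᵗ s t)  = eqᶠ σ z s ∨̇ eqᶠ σ z t
  memᶠ σ z (⋃ᵗ s)       = ∃̇ (memᶠ (suc ∘ σ) 0F s ∧̇ suc z ∈̇ 0F)
  memᶠ σ z (imageᵗ s t) = ∃̇ (memᶠ (suc ∘ σ) 0F s ∧̇ eqᶠ (Fin.lift 1 σ) (suc z) t)
  eqᶠ σ z t =
    ∀̇ ((0F ∈̇ suc z ⇒̇ memᶠ (suc ∘ σ) 0F t) ∧̇ (memᶠ (suc ∘ σ) 0F t ⇒̇ 0F ∈̇ suc z))

infix 8 _∈ᶠ_
opaque
  -- `memᶠ` has the term to the right of membership. Here it stands on the left, so its value is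
  -- first named by a quantifier.
  _∈ᶠ_ : Term n → Fin n → Formula n
  t ∈ᶠ z = ∃̇ (eqᶠ suc 0F t ∧̇ 0F ∈̇ suc z)

-- Names

component : (G x : 𝕍 ℓ) → Coded G x → 𝕍 ℓ
component G x (j , k , _) = el (el x j) k

valAt≡ : ∀ (G y : 𝕍 ℓ) k → valAt G y k ≡ val G (el y k)
valAt≡ G (sup K h) k = refl

-- `valCoded` and `valAt` match on trees only to make the recursion of `val` structural; this is the
-- equation they stand for.
valCoded≡ : ∀ (G x : 𝕍 ℓ) s → valCoded G x s ≡ val G (component G x s)
valCoded≡ G (sup J h) (j , k , _) = valAt≡ G (h j) k

-- `Coded` consists of indices into `x`, which are found by following the memberships of `σ` in
-- `pair σ σ` and of `pair σ σ` in the ordered pair.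
code : ∀ (G : 𝕍 ℓ) {x σ q} → x ≈ ⟪ σ , q ⟫ → q ∈ G →
  ∃ᶜ λ (s : Coded G x) → component G x s ≈ σ
code G {x} {σ} {q} e q∈G = do
  j , d ← ∈-respʳ {y = ⟪ σ , q ⟫} (≈-sym e) (∈pairˡ (pair σ σ) (pair σ q))
  k , σ≈ ← ∈-respʳ d (∈pairˡ σ σ)
  g , q≈ ← q∈G
  return ((j , k , g , ≈-trans e (⟪⟫-cong σ≈ q≈)) , ≈-sym σ≈)

module _ (G : 𝕍 ℓ) where

  mutual
    -- Induction on the tree of `x` alone. The two companion lemmas follow the recursion of `val`
    -- down to a subtree.
    val-cong : x ≈ y → val G x ≈ val G y
    val-cong {x = sup I f} {sup J g} (p , q) =
      (λ (i , s) → do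
        j , d ← p i
        t , e ← recode (f i) s (≈-sym d)
        return ((j , t) , transport s t (≈-sym e))) ,
      (λ (j , t) → do
        i , d ← q j
        s , e ← recode (g j) t d
        return ((i , s) , transport s t e))
      where
      recode : ∀ x {y} (s : Coded G x) → y ≈ x →
        ∃ᶜ λ (t : Coded G y) → component G y t ≈ component G x s
      recode x (_ , _ , g , e) d = code G (≈-trans d e) (el∈ G g)
      transport : ∀ {i j} (s : Coded G (f i)) (t : Coded G (g j)) →
        component G (f i) s ≈ component G (g j) t →
        valCoded G (f i) s ≈ valCoded G (g j) t
      transport {i} {j} s t e = subst (valCoded G (f i) s ≈_) (sym (valCoded≡ G (g j) t))
        (valCoded-cong (f i) s e)

    valCoded-cong : ∀ x (s : Coded G x) → component G x s ≈ y → valCoded G x s ≈ val G y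
    valCoded-cong (sup J h) (j , k , _) e = valAt-cong (h j) k e

    valAt-cong : ∀ x k → el x k ≈ y → valAt G x k ≈ val G y
    valAt-cong (sup K h) k e = val-cong e

  ∈val : ∀ τ {σ q} → ⟪ σ , q ⟫ ∈ τ → q ∈ G → x ≈ val G σ → x ∈ val G τ
  ∈val (sup I f) σ,q∈τ q∈G e = do
    i , d ← σ,q∈τ
    s , c ← code G (≈-sym d) q∈G
    return ((i , s) , ≈-trans e (≈-sym (valCoded-cong (f i) s c)))

  ∈val⁻ : ∀ τ → x ∈ val G τ → ∃ᶜ λ σ → ∃ λ q → ⟪ σ , q ⟫ ∈ τ × q ∈ G × x ≈ val G σ
  ∈val⁻ (sup I f) x∈ = do
    (i , s@(_ , _ , g , d)) , e ← x∈
    return (component G (f i) s , el G g , return (i , ≈-sym d) , el∈ G g ,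
      ≈-trans e (valCoded-cong (f i) s ≈-refl))

  module _ {p : 𝕍 ℓ} (p∈G : p ∈ G) where

    -- Every member of the name is tagged with `p`, which lies in `G`, so none is lost in the
    -- evaluation.
    val-pair : ∀ σ τ → val G (pair ⟪ σ , p ⟫ ⟪ τ , p ⟫) ≈ pair (val G σ) (val G τ)
    val-pair σ τ = ≈-ext
      (λ z z∈ → do
        _ , _ , m , _ , e ← ∈val⁻ (pair ⟪ σ , p ⟫ ⟪ τ , p ⟫) z∈
        ∈pair⁻ m >>=
          [ (λ d → ∈-respˡ P (≈-sym (≈-trans e (val-cong (⟪⟫-injectiveˡ d))))
                     (∈pairˡ (val G σ) (val G τ)))
          , (λ d → ∈-respˡ P (≈-sym (≈-trans e (val-cong (⟪⟫-injectiveˡ d))))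
                     (∈pairʳ (val G σ) (val G τ))) ]′)
      (λ z z∈ → ∈pair⁻ z∈ >>=
        [ ∈val Q (∈pairˡ ⟪ σ , p ⟫ ⟪ τ , p ⟫) p∈G , ∈val Q (∈pairʳ ⟪ σ , p ⟫ ⟪ τ , p ⟫) p∈G ]′)
      where
      P = pair (val G σ) (val G τ)
      Q = pair ⟪ σ , p ⟫ ⟪ τ , p ⟫

    val-sup : ∀ I (σ : I → 𝕍 ℓ) → val G (sup I λ i → ⟪ σ i , p ⟫) ≈ sup I (val G ∘ σ)
    val-sup I σ =
      (λ (i , s@(_ , _ , _ , e)) →
        return (i , valCoded-cong ⟪ σ i , p ⟫ s (≈-sym (⟪⟫-injectiveˡ e)))) ,
      (λ i → do
        s , e ← code G (≈-refl {x = ⟪ σ i , p ⟫}) p∈G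
        return ((i , s) , valCoded-cong ⟪ σ i , p ⟫ s e))

    -- Members of `τ` keep their own conditions, and the new member is tagged with `p`.
    val-insert : ∀ τ σ → val G (insert τ ⟪ σ , p ⟫) ≈ insert (val G τ) (val G σ)
    val-insert τ σ = ≈-ext
      (λ z z∈ → do
        _ , _ , m , q∈G , e ← ∈val⁻ (insert τ ⟪ σ , p ⟫) z∈
        ∈insert⁻ τ ⟪ σ , p ⟫ m >>=
          [ (λ m′ → insert-⊆ (val G τ) (val G σ) z (∈val τ m′ q∈G e))
          , (λ d → ∈-respˡ (insert (val G τ) (val G σ))
                     (≈-sym (≈-trans e (val-cong (⟪⟫-injectiveˡ d)))) (∈insert (val G τ) (val G σ))) ]′)
      (λ z z∈ → ∈insert⁻ (val G τ) (val G σ) z∈ >>=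
        [ (λ z∈τ → do
            _ , _ , m , q∈G , e ← ∈val⁻ τ z∈τ
            ∈val (insert τ ⟪ σ , p ⟫) (insert-⊆ τ ⟪ σ , p ⟫ _ m) q∈G e)
        , ∈val (insert τ ⟪ σ , p ⟫) (∈insert τ ⟪ σ , p ⟫) p∈G ]′)

-- The canonical name of n, with p in the role of the weakest condition.
numName : 𝕍 ℓ → ℕ → 𝕍 ℓ
numName p zero    = ∅
numName p (suc n) = insert (numName p n) ⟪ numName p n , p ⟫

numNames : 𝕍 ℓ → 𝕍 ℓ
numNames p = sup (Lift _ ℕ) (numName p ∘ lower)

-- The Kuratowski pair at the level of names, with `p` attached to the members of each layer.
opName : 𝕍 ℓ → 𝕍 ℓ → 𝕍 ℓ → 𝕍 ℓ
opName p σ τ = pair ⟪ pair ⟪ σ , p ⟫ ⟪ σ , p ⟫ , p ⟫ ⟪ pair ⟪ σ , p ⟫ ⟪ τ , p ⟫ , p ⟫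

opNameᵗ : Term n → Term n → Term n → Term n
opNameᵗ p s t =
  pairᵗ ⟪ pairᵗ ⟪ s , p ⟫ᵗ ⟪ s , p ⟫ᵗ , p ⟫ᵗ ⟪ pairᵗ ⟪ s , p ⟫ᵗ ⟪ t , p ⟫ᵗ , p ⟫ᵗ

-- The free variables are the set of numeral names and `p`. In the body, `var 1F` and `var 0F` are
-- the names of the two coordinates and `var 3F` is `p`. The union of an image of images yields a
-- family over pairs.
π₁Nameᵗ : Term 2
π₁Nameᵗ = ⋃ᵗ (imageᵗ (var 0F) (imageᵗ (var 1F)
  ⟪ opNameᵗ (var 3F) (opNameᵗ (var 3F) (var 1F) (var 0F)) (var 1F) , var 3F ⟫ᵗ))

-- Definitionally ⟦ π₁Nameᵗ ⟧ (numNames p ∷ p ∷ []).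
π₁Name : 𝕍 ℓ → 𝕍 ℓ
π₁Name {ℓ} p = sup (idx (ω {ℓ}) × idx (ω {ℓ})) λ (lift m , lift n) →
  ⟪ opName p (opName p (numName p m) (numName p n)) (numName p m) , p ⟫

module _ (G : 𝕍 ℓ) {p : 𝕍 ℓ} (p∈G : p ∈ G) where

  val-∅ : val G ∅ ≈ ∅
  val-∅ = (λ ()) , (λ ())

  val-numName : ∀ n → val G (numName p n) ≈ num n
  val-numName zero    = val-∅
  val-numName (suc n) = ≈-trans (val-insert G p∈G (numName p n) (numName p n))
    (≈-trans (insert-cong (val-numName n) (val-numName n)) (insert≈succ (num n)))

  val-opName : ∀ σ τ → val G (opName p σ τ) ≈ ⟪ val G σ , val G τ ⟫
  val-opName σ τ = ≈-trans (val-pair G p∈G _ _)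
    (pair-cong (val-pair G p∈G σ σ) (val-pair G p∈G σ τ))

  val-opName-num : ∀ m n → val G (opName p (opName p (numName p m) (numName p n)) (numName p m)) ≈
    ⟪ ⟪ num m , num n ⟫ , num m ⟫
  val-opName-num m n = ≈-trans (val-opName _ (numName p m)) (⟪⟫-cong
    (≈-trans (val-opName (numName p m) (numName p n)) (⟪⟫-cong (val-numName m) (val-numName n)))
    (val-numName m))

  π₁≈val : π₁ ≈ val G (π₁Name p)
  π₁≈val = ≈-sym (≈-trans (val-sup G p∈G _ _)
    ((λ (lift m , lift n) → return ((lift m , lift n) , val-opName-num m n)) ,
     (λ (lift m , lift n) → return ((lift m , lift n) , val-opName-num m n))))

-- Closure properties of a transitive model

module TransitiveModel {M : Pred (𝕍 ℓ) c} (isTransitiveModel : IsTransitiveModel M) where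
  open IsTransitiveModel isTransitiveModel
  open IsZFC isZFC

  -- Pairing gives a set in `M` with `x`, and hence `y`, as a member; transitivity does the rest.
  M-resp : x ≈ y → M x → M y
  M-resp {x = x} {y} e Mx = stable y do
    z , Mz , h ← pairing x Mx x Mx
    return (transitive y z (∈-respˡ z e (from (h x Mx) (return (inj₁ ≈-refl)))) Mz)

  -- An axiom in `M` determines the members of `z` only among elements of `M`. All members of `z`
  -- are such by transitivity, those of `y` by hypothesis, so the two sets are equal.
  M-ext : (∃ᶜ λ z → M z × (∀ w → M w → w ∈ z ⇔ w ∈ y)) → (∀ w → w ∈ y → M w) → M y
  M-ext {y = y} m M-y = stable y do
    z , Mz , h ← m
    return (M-resp (≈-ext (λ w w∈z → to (h w (transitive w z w∈z Mz)) w∈z)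
                          (λ w w∈y → from (h w (M-y w w∈y)) w∈y)) Mz)

  -- Infinity is the axiom that asserts existence outright, and its witness contains a set without
  -- members.
  M-∅ : M ∅
  M-∅ = M-ext
    (do _ , _ , m , _ ← infinity
        e , Me , _ , empty ← m
        return (e , Me , λ z Mz → mk⇔ (λ z∈e → contradiction z∈e (empty z Mz))
                                      (λ z∈∅ → contradiction z∈∅ (∉∅ z))))
    (λ z z∈∅ → contradiction z∈∅ (∉∅ z))

  M-pair : M x → M y → M (pair x y)
  M-pair {x = x} {y} Mx My = M-ext
    (do z , Mz , h ← pairing x Mx y My
        return (z , Mz , λ w Mw → mk⇔ (λ w∈z → to (h w Mw) w∈z >>=
            [ (λ e → ∈-respˡ (pair x y) (≈-sym e) (∈pairˡ x y))
            , (λ e → ∈-respˡ (pair x y) (≈-sym e) (∈pairʳ x y)) ]′)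
          (λ w∈ → from (h w Mw) (∈pair⁻ w∈))))
    (λ w w∈ → stable w do
        ∈pair⁻ w∈ >>= [ (λ e → return (M-resp (≈-sym e) Mx)) , (λ e → return (M-resp (≈-sym e) My)) ]′)

  M-⋃ : M x → M (⋃ x)
  M-⋃ {x = x} Mx = M-ext
    (do u , Mu , h ← union x Mx
        return (u , Mu , λ w Mw → mk⇔
          (λ w∈u → do y , My , y∈x , w∈y ← to (h w Mw) w∈u ; ∈⋃ x y∈x w∈y)
          (λ w∈ → do
            y , y∈x , w∈y ← ∈⋃⁻ x w∈
            from (h w Mw) (return (y , transitive y x y∈x Mx , y∈x , w∈y)))))
    (λ w w∈ → stable w do
        y , y∈x , w∈y ← ∈⋃⁻ x w∈
        return (transitive w y w∈y (transitive y x y∈x Mx)))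

  M-⟪⟫ : M x → M y → M ⟪ x , y ⟫
  M-⟪⟫ Mx My = M-pair (M-pair Mx Mx) (M-pair Mx My)

  M-insert : M x → M y → M (insert x y)
  M-insert Mx My = M-⋃ (M-pair Mx (M-pair My My))

  M-num : ∀ n → M (num n)
  M-num zero    = M-∅
  M-num (suc n) = M-resp (insert≈succ (num n)) (M-insert (M-num n) (M-num n))

  -- Finiteness in the model

  finite-∅ : ∀ {X} → (∀ z → ¬ (z ∈ X)) → Finite M X
  finite-∅ empty = return (∅ , num∈ω 0 , return (∅ , M-∅ , record
    { isFunction = record
      { graph      = λ z z∈ → contradiction z∈ (∉∅ z)
      ; total      = λ x x∈ → contradiction x∈ (∉∅ x)
      ; functional = λ x y z p → contradiction p (∉∅ _)
      }
    ; injective  = λ x y z p → contradiction p (∉∅ _)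
    ; surjective = λ y y∈ → contradiction y∈ (empty y)
    }))

  -- The bijection from `k` onto `X` is extended by sending `k` to `y`. Old and new pairs do not
  -- conflict, since `k` is not in `k` and `y` is not in `X`.
  finite-insert : ∀ {X Y y} → Finite M X → M y → ¬ (y ∈ X) →
    X ⊆ Y → y ∈ Y → (∀ z → z ∈ Y → z ∈ X ∨ᶜ z ≈ y) → Finite M Y
  finite-insert {X} {Y} {y} fin My y∉X X⊆Y y∈Y Y⊆ = do
    k , k∈ω , m ← fin
    n , k≈n ← ∈ω⁻ k∈ω
    f , Mf , bij ← m
    let open IsBijection bij
        open IsFunction isFunction
        g = insert f ⟪ k , y ⟫
        old : f ⊆ g
        old = insert-⊆ f ⟪ k , y ⟫
        new : ⟪ k , y ⟫ ∈ g
        new = ∈insert f ⟪ k , y ⟫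
        split : ∀ {x z} → ⟪ x , z ⟫ ∈ g → ⟪ x , z ⟫ ∈ f ∨ᶜ (x ≈ k × z ≈ y)
        split = λ p → ∈insert⁻ f ⟪ k , y ⟫ p >>=
          [ (λ q → return (inj₁ q)) , (λ e → return (inj₂ (⟪⟫-injectiveˡ e , ⟪⟫-injectiveʳ e))) ]′
        not-old : ∀ {x z} {C : Set _} → ⟪ x , z ⟫ ∈ f → x ≈ k → C
        not-old = λ p e →
          contradiction (∈-respˡ k e (∈⊗⁻ˡ {A = k} {B = X} (graph _ p))) (∈-irrefl k)
        not-old′ : ∀ {x z} {C : Set _} → ⟪ x , z ⟫ ∈ f → z ≈ y → C
        not-old′ = λ p e →
          contradiction (∈-respˡ X e (∈⊗⁻ʳ {A = k} {B = X} (graph _ p))) y∉X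
    return (succ k
      , return (lift (suc n) , ≈-trans (≈-sym (insert≈succ k))
          (≈-trans (insert-cong k≈n k≈n) (insert≈succ (num n))))
      , return (g , M-insert Mf (M-⟪⟫ (M-resp (≈-sym k≈n) (M-num n)) My) , record
        { isFunction = record
          { graph = λ z z∈ → ∈insert⁻ f ⟪ k , y ⟫ z∈ >>=
              [ (λ z∈f → ⊗-mono k (succ k) X Y (succ-⊆ k) X⊆Y z (graph z z∈f))
              , (λ e → ∈-respˡ (succ k ⊗ Y) (≈-sym e) (∈⊗ (succ k) Y (∈succ k) y∈Y)) ]′
          ; total = λ x x∈ → ∈succ⁻ x∈ >>=
              [ (λ x∈k → do z , p ← total x x∈k ; return (z , old _ p))
              , (λ e → return (y , ∈-respˡ g (⟪⟫-cong (≈-sym e) ≈-refl) new)) ]′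
          ; functional = λ x z w p q → ≈-stable do
              p′ ← split p
              q′ ← split q
              return (case₂ (functional x z w) (λ p e → not-old p (proj₁ e))
                (λ e q → not-old q (proj₁ e)) (λ d e → ≈-trans (proj₂ d) (≈-sym (proj₂ e))) p′ q′)
          }
        ; injective = λ x w z p q → ≈-stable do
            p′ ← split p
            q′ ← split q
            return (case₂ (injective x w z) (λ p e → not-old′ p (proj₂ e))
              (λ e q → not-old′ q (proj₂ e)) (λ d e → ≈-trans (proj₁ d) (≈-sym (proj₁ e))) p′ q′)
        ; surjective = λ z z∈Y → Y⊆ z z∈Y >>=
            [ (λ z∈X → do x , p ← surjective z z∈X ; return (x , old _ p))
            , (λ e → return (k , ∈-respˡ g (⟪⟫-cong ≈-refl (≈-sym e)) new)) ]′
        }))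
    where
    case₂ : ∀ {p q r s t} {P : Set p} {Q : Set q} {R : Set r} {S : Set s} {T : Set t} →
      (P → R → T) → (P → S → T) → (Q → R → T) → (Q → S → T) → P ⊎ Q → R ⊎ S → T
    case₂ f g h k (inj₁ p) (inj₁ r) = f p r
    case₂ f g h k (inj₁ p) (inj₂ s) = g p s
    case₂ f g h k (inj₂ q) (inj₁ r) = h q r
    case₂ f g h k (inj₂ q) (inj₂ s) = k q s

  -- `R` is an arbitrary relation of the metatheory, so a bijection outside `M` can be used. The
  -- bijection in `M` is built anew, one element at a time: removing the element related to `n`
  -- leaves a set covered by the indices below `n`.
  finite-cover : ∀ n (R : ℕ → 𝕍 ℓ → Set a) → (∀ {i x y} → R i x → R i y → x ≈ y) →
    ∀ {X} → (∀ z → z ∈ X → M z) → (∀ z → z ∈ X → ∃ᶜ λ i → i < n × R i z) → Finite M X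
  finite-cover zero    R R-fun M-X cover = finite-∅ λ z z∈X → cover z z∈X λ { (_ , () , _) }
  finite-cover (suc n) R R-fun {X} M-X cover =
    ¬¬-excluded-middle {A = ∃ λ y → y ∈ X × R n y} >>= λ where
      (no none) → finite-cover n R R-fun M-X λ z z∈X → do
        i , i<1+n , r ← cover z z∈X
        case-last i<1+n (λ i<n → return (i , i<n , r))
          λ { refl → contradiction (z , z∈X , r) none }
      (yes (y , y∈X , Rny)) →
        let Z = X ∖ pair y y in
        finite-insert {Z} {X}
          (finite-cover n R R-fun (λ z z∈Z → M-X z (∖-⊆ X (pair y y) z z∈Z)) λ z z∈Z → do
            i , i<1+n , r ← cover z (∖-⊆ X (pair y y) z z∈Z)
            case-last i<1+n (λ i<n → return (i , i<n , r))
              -- Anything else related to `n` would equal `y`, which has been removed.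
              λ { refl → contradiction (∈-respˡ (pair y y) (R-fun Rny r) (∈pairˡ y y))
                                       (∈∖⁻ X (pair y y) z∈Z) })
          (M-X y y∈X)
          (λ y∈Z → ∈∖⁻ X (pair y y) y∈Z (∈pairˡ y y))
          (∖-⊆ X (pair y y)) y∈X
          (λ z z∈X → ¬¬-excluded-middle {A = z ≈ y} >>= λ where
            (yes z≈y) → return (inj₂ z≈y)
            (no z≉y)  → return (inj₁ (∈∖ X (pair y y) z∈X (z≉y ∘ ∈singleton⁻))))
    where
    case-last : ∀ {i n} {C : Set b} → i < suc n → (i < n → C) → (i ≡ n → C) → C
    case-last i<1+n f g = [ f , g ]′ (m<1+n⇒m<n∨m≡n i<1+n)

  M-∈ω : x ∈ ω → M x
  M-∈ω {x = x} x∈ω = stable x do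
    n , e ← ∈ω⁻ x∈ω
    return (M-resp (≈-sym e) (M-num n))

  -- The first projection on a condition

  -- The bijection `f` onto the fibre belongs to `N`. It enters only as the relation between `i` and
  -- the second coordinate of the point numbered `i`, to which `finite-cover` applies.
  finite-section : ∀ {e} (N : Pred (𝕍 ℓ) e) A n → A ⊆ ω² → n ∈ ω →
    Finite N (fibre π₁ A n) → Finite M (section A n)
  finite-section N A n A⊆ω² n∈ω fin = do
    k , k∈ω , m ← fin
    j , k≈j ← ∈ω⁻ k∈ω
    f , _ , bij ← m
    let open IsBijection bij
        open IsFunction isFunction
    finite-cover j (λ i x → ⟪ num i , ⟪ n , x ⟫ ⟫ ∈ f)
      (λ p q → ⟪⟫-injectiveʳ (functional _ _ _ p q))
      (λ z z∈ → M-∈ω (section-⊆ω A n z z∈))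
      (λ z z∈ → do
        let ⟪n,z⟫∈A = ∈section⁻ A n z∈
            ⟪n,z⟫∈ω² = A⊆ω² _ ⟪n,z⟫∈A
        x , p ← surjective ⟪ n , z ⟫ (∈fibre π₁ A n ⟪n,z⟫∈A (∈π₁ n∈ω (section-⊆ω A n z z∈)))
        i , i<j , x≈i ← ∈num⁻ j (∈-respʳ k≈j (∈⊗⁻ˡ {A = k} {B = fibre π₁ A n} (graph _ p)))
        return (i , i<j , ∈-respˡ f (⟪⟫-cong x≈i (≈-refl {x = ⟪ n , z ⟫})) p))

  -- Finite fibres would make every section finite in `M`, and the infinite set `D` of rows with an
  -- infinite section would be empty.
  ¬finiteToOne : ∀ {e} (N : Pred (𝕍 ℓ) e) A → ℙ M A → ¬ FiniteToOneOn N π₁ A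
  ¬finiteToOne N A (_ , A⊆ω² , infinite) fto = infinite λ where
    (D , _ , (D⊆ω , D-spec) , D-infinite) → D-infinite (finite-∅ λ n n∈D →
      let n∈ω = D⊆ω n n∈D in
      to (D-spec n n∈ω) n∈D (finite-section N A n A⊆ω² n∈ω (fto n n∈ω)))

  -- Each row in `D` contains a point of `A`, so a constant value `k` would make `D` a subset of a
  -- singleton.
  ¬constant : ∀ A → ℙ M A → ¬ ConstantOn π₁ A
  ¬constant A (_ , A⊆ω² , infinite) constant = infinite λ where
    (D , _ , (D⊆ω , D-spec) , D-infinite) → constant λ (k , k∈ω , const) →
      D-infinite (finite-cover 1 (λ _ z → z ≈ k) (λ d e → ≈-trans d (≈-sym e))
        (λ z z∈D → M-∈ω (D⊆ω z z∈D))
        -- A row other than `k` has no point of `A`, so its section would be empty and thus finite.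
        (λ n n∈D → return (0 , n<1+n 0 , ≈-stable λ n≉k →
          to (D-spec n (D⊆ω n n∈D)) n∈D (finite-∅ λ m m∈ →
            n≉k (∈π₁⁻-first (const _ (∈section⁻ A n m∈)))))))

  -- An infinite set of natural numbers is unbounded, so its union is `ω`.
  M-ω : ∀ {D} → M D → D ⊆ ω → Infinite M D → M ω
  M-ω {D} MD D⊆ω D-infinite = M-resp (≈-ext
    (λ z z∈ → do
      d , d∈D , z∈d ← ∈⋃⁻ D z∈
      n , d≈n ← ∈ω⁻ (D⊆ω d d∈D)
      m , _ , z≈m ← ∈num⁻ n (∈-respʳ d≈n z∈d)
      return (lift m , z≈m))
    (λ z z∈ω z∉⋃ → ∈ω⁻ z∈ω λ (n , z≈n) → D-infinite
      -- If `n` is not in the union, no member of `D` exceeds `n`. As `n` itself may be a member,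
      -- the bound is `suc n`.
      (finite-cover (suc n) (λ i x → x ≈ num i) (λ d e → ≈-trans d (≈-sym e))
        (λ d d∈D → M-∈ω (D⊆ω d d∈D))
        (λ d d∈D → do
          m , d≈m ← ∈ω⁻ (D⊆ω d d∈D)
          return (m , ≰⇒> (λ n<m → ∈⋃ D d∈D
            (∈-respʳ (≈-sym d≈m) (∈-respˡ (num m) (≈-sym z≈n) (num-< n<m))) z∉⋃) , d≈m)))))
    (M-⋃ MD)

  -- Values of terms in the model, and correctness of the formulas

  mutual
    M-⟦⟧ : (t : Term n) {η : Vec (𝕍 ℓ) n} → All M η → M (⟦ t ⟧ η)
    M-⟦⟧ (var i)      Mη = lookup⁺ Mη i
    M-⟦⟧ (pairᵗ s t)  Mη = M-pair (M-⟦⟧ s Mη) (M-⟦⟧ t Mη)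
    M-⟦⟧ (⋃ᵗ s)       Mη = M-⋃ (M-⟦⟧ s Mη)
    M-⟦⟧ (imageᵗ s t) {η} Mη = M-ext
      -- The formula says that variable 1 is the value of `t` at variable 0, which is functional by
      -- `sat`.
      (do Y , MY , h ← replacement (eqᶠ σ 1F t) η Mη
            (λ x Mx y My z Mz p q → ≈-trans (to (sat x Mx y My) p) (≈-sym (to (sat x Mx z Mz) q)))
            S (M-⟦⟧ s Mη)
          return (Y , MY , λ w Mw → mk⇔
            (λ w∈Y → do
              x , Mx , x∈S , p ← to (h w Mw) w∈Y
              ∈image s t η x∈S (to (sat x Mx w Mw) p))
            (λ w∈ → from (h w Mw) do
              i , e ← w∈
              let Mx = M-el i
              return (el S i , Mx , el∈ S i , from (sat (el S i) Mx w Mw) e))))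
      (λ w w∈ → stable w do
        i , e ← w∈
        return (M-resp (≈-sym e) (M-⟦⟧ t (M-el i ∷ Mη))))
      where
      S = ⟦ s ⟧ η
      M-el : ∀ i → M (el S i)
      M-el i = transitive _ S (el∈ S i) (M-⟦⟧ s Mη)
      -- Skips variable 1, the value `y`, which does not occur in `t`.
      σ : Fin (suc _) → Fin (suc (suc _))
      σ 0F      = 0F
      σ (suc i) = suc (suc i)
      sat : ∀ x → M x → ∀ y → M y →
        M ⊨ eqᶠ σ 1F t [ x ∷ y ∷ η ] ⇔ y ≈ ⟦ t ⟧ (x ∷ η)
      sat x Mx y My = sat-eq t (Mx ∷ Mη) (Mx ∷ My ∷ Mη) 1F
        λ { 0F → refl ; (suc i) → refl }

    -- The quantifiers in `memᶠ` range over `M` only. This loses no witness, since the witnesses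
    -- belong to values of terms, which are in the transitive class `M`.
    sat-mem : (t : Term m) {η : Vec (𝕍 ℓ) m} {ρ : Vec (𝕍 ℓ) n} {σ : Fin m → Fin n} →
      All M η → All M ρ → ∀ z → (∀ i → lookup ρ (σ i) ≡ lookup η i) →
      M ⊨ memᶠ σ z t [ ρ ] ⇔ lookup ρ z ∈ ⟦ t ⟧ η
    sat-mem (var i) {ρ = ρ} Mη Mρ z e = mk⇔
      (λ p → subst (lookup ρ z ∈_) (e i) (lower p))
      (λ p → lift (subst (lookup ρ z ∈_) (sym (e i)) p))
    sat-mem (pairᵗ s t) {η} {ρ} Mη Mρ z e = mk⇔
      (λ p → p >>=
        [ (λ q → ∈-respˡ P (≈-sym (to sat-s q)) (∈pairˡ (⟦ s ⟧ η) (⟦ t ⟧ η)))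
        , (λ q → ∈-respˡ P (≈-sym (to sat-t q)) (∈pairʳ (⟦ s ⟧ η) (⟦ t ⟧ η))) ]′)
      (λ p → ∈pair⁻ p >>=
        [ (λ q → return (inj₁ (from sat-s q))) , (λ q → return (inj₂ (from sat-t q))) ]′)
      where
      P = pair (⟦ s ⟧ η) (⟦ t ⟧ η)
      sat-s = sat-eq s Mη Mρ z e
      sat-t = sat-eq t Mη Mρ z e
    sat-mem (⋃ᵗ s) {η} Mη Mρ z e = mk⇔
      (λ p → do
        y , My , y∈ , z∈y ← p
        ∈⋃ (⟦ s ⟧ η) (to (sat-mem s Mη (My ∷ Mρ) 0F e) y∈) (lower z∈y))
      (λ p → do
        y , y∈ , z∈y ← ∈⋃⁻ (⟦ s ⟧ η) p
        let My = transitive y (⟦ s ⟧ η) y∈ (M-⟦⟧ s Mη)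
        return (y , My , from (sat-mem s Mη (My ∷ Mρ) 0F e) y∈ , lift z∈y))
    sat-mem (imageᵗ s t) {η} Mη Mρ z e = mk⇔
      (λ p → do
        x , Mx , x∈ , z≈ ← p
        ∈image s t η (to (sat-mem s Mη (Mx ∷ Mρ) 0F e) x∈)
          (to (sat-eq t (Mx ∷ Mη) (Mx ∷ Mρ) (suc z) λ { 0F → refl ; (suc i) → e i }) z≈))
      (λ p → do
        i , d ← p
        let x∈ = el∈ (⟦ s ⟧ η) i
            Mx = transitive _ (⟦ s ⟧ η) x∈ (M-⟦⟧ s Mη)
        return (_ , Mx , from (sat-mem s Mη (Mx ∷ Mρ) 0F e) x∈ ,
          from (sat-eq t (Mx ∷ Mη) (Mx ∷ Mρ) (suc z) λ { 0F → refl ; (suc i) → e i }) d))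

    -- Both sides are in `M`, so by transitivity they are equal once they have the same members in
    -- `M`.
    sat-eq : (t : Term m) {η : Vec (𝕍 ℓ) m} {ρ : Vec (𝕍 ℓ) n} {σ : Fin m → Fin n} →
      All M η → All M ρ → ∀ z → (∀ i → lookup ρ (σ i) ≡ lookup η i) →
      M ⊨ eqᶠ σ z t [ ρ ] ⇔ lookup ρ z ≈ ⟦ t ⟧ η
    sat-eq t {η} {ρ} Mη Mρ z e = mk⇔
      (λ p → ≈-ext
        (λ w w∈ → let Mw = transitive w (lookup ρ z) w∈ (lookup⁺ Mρ z) in
          to (sat-mem t Mη (Mw ∷ Mρ) 0F e) (proj₁ (p w Mw) (lift w∈)))
        (λ w w∈ → let Mw = transitive w (⟦ t ⟧ η) w∈ (M-⟦⟧ t Mη) in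
          lower (proj₂ (p w Mw) (from (sat-mem t Mη (Mw ∷ Mρ) 0F e) w∈))))
      (λ z≈t w Mw →
        (λ w∈z → from (sat-mem t Mη (Mw ∷ Mρ) 0F e) (∈-respʳ z≈t (lower w∈z))) ,
        (λ w∈t → lift (∈-respʳ (≈-sym z≈t) (to (sat-mem t Mη (Mw ∷ Mρ) 0F e) w∈t))))

  opaque
    unfolding _∈ᶠ_

    sat-∈ᶠ : (t : Term n) {ρ : Vec (𝕍 ℓ) n} → All M ρ → ∀ z →
      M ⊨ t ∈ᶠ z [ ρ ] ⇔ ⟦ t ⟧ ρ ∈ lookup ρ z
    sat-∈ᶠ t {ρ} Mρ z = mk⇔
      (λ p → do
        x , Mx , x≈t , x∈z ← p
        ∈-respˡ (lookup ρ z) (to (sat-eq t Mρ (Mx ∷ Mρ) 0F λ _ → refl) x≈t) (lower x∈z))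
      (λ t∈z → let Mt = M-⟦⟧ t Mρ in
        return (⟦ t ⟧ ρ , Mt , from (sat-eq t Mρ (Mt ∷ Mρ) 0F λ _ → refl) ≈-refl , lift t∈z))

  -- Recursion inside M: the graph of numName p up to num n is the least g
  -- with Closed p (num n) g.
  Closed : (p x g : 𝕍 ℓ) → Set (lsuc ℓ ⊔ c)
  Closed p x g = ⟪ ∅ , ∅ ⟫ ∈ g × (∀ i → M i → ∀ u → M u → i ∈ x → ⟪ i , u ⟫ ∈ g →
    ⟪ insert i i , insert u ⟪ u , p ⟫ ⟫ ∈ g)

  Derivable : (p x y : 𝕍 ℓ) → Set (lsuc ℓ ⊔ c)
  Derivable p x y = ∀ g → M g → Closed p x g → ⟪ x , y ⟫ ∈ g

  graphUpTo : 𝕍 ℓ → ℕ → 𝕍 ℓ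
  graphUpTo p zero    = pair ⟪ ∅ , ∅ ⟫ ⟪ ∅ , ∅ ⟫
  graphUpTo p (suc n) = insert (graphUpTo p n) ⟪ num (suc n) , numName p (suc n) ⟫

  M-numName : ∀ {p} → M p → ∀ n → M (numName p n)
  M-numName Mp zero    = M-∅
  M-numName Mp (suc n) = M-insert (M-numName Mp n) (M-⟪⟫ (M-numName Mp n) Mp)

  M-graph : ∀ {p} → M p → ∀ n → M (graphUpTo p n)
  M-graph Mp zero    = M-pair (M-⟪⟫ M-∅ M-∅) (M-⟪⟫ M-∅ M-∅)
  M-graph Mp (suc n) = M-insert (M-graph Mp n) (M-⟪⟫ (M-num (suc n)) (M-numName Mp (suc n)))

  ∈graphUpTo : ∀ p {m} n → m < suc n → ⟪ num m , numName p m ⟫ ∈ graphUpTo p n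
  ∈graphUpTo p zero    (s≤s z≤n) = ∈pairˡ ⟪ ∅ , ∅ ⟫ ⟪ ∅ , ∅ ⟫
  ∈graphUpTo p (suc n) m<2+n with m<1+n⇒m<n∨m≡n m<2+n
  ... | inj₁ m<1+n = insert-⊆ (graphUpTo p n) _ _ (∈graphUpTo p n m<1+n)
  ... | inj₂ refl  = ∈insert (graphUpTo p n) _

  ∈graphUpTo⁻ : ∀ p n {z} → z ∈ graphUpTo p n → ∃ᶜ λ m → z ≈ ⟪ num m , numName p m ⟫
  ∈graphUpTo⁻ p zero    z∈ = return (0 , ∈singleton⁻ z∈)
  ∈graphUpTo⁻ p (suc n) z∈ = ∈insert⁻ (graphUpTo p n) _ z∈ >>=
    [ ∈graphUpTo⁻ p n , (λ e → return (suc n , e)) ]′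

  graph-functional : ∀ p n {m y} → ⟪ num m , y ⟫ ∈ graphUpTo p n → y ≈ numName p m
  graph-functional p n {y = y} m,y∈ = ≈-stable do
    k , e ← ∈graphUpTo⁻ p n m,y∈
    return (subst (λ i → y ≈ numName p i) (sym (num-injective (⟪⟫-injectiveˡ e)))
      (⟪⟫-injectiveʳ e))

  step-cong : ∀ (p : 𝕍 ℓ) {i u n} → i ≈ num n → u ≈ numName p n →
    ⟪ insert i i , insert u ⟪ u , p ⟫ ⟫ ≈ ⟪ num (suc n) , numName p (suc n) ⟫
  step-cong p {n = n} d e = ⟪⟫-cong (≈-trans (insert-cong d d) (insert≈succ (num n)))
    (insert-cong e (⟪⟫-cong e (≈-refl {x = p})))

  -- The step clause is restricted to `i ∈ num n`, so it never leads past the last pair of the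
  -- finite graph.
  graph-closed : ∀ p n → Closed p (num n) (graphUpTo p n)
  graph-closed p n = ∈graphUpTo p n (s≤s z≤n) , λ i Mi u Mu i∈n i,u∈ → do
    m , m<n , i≈m ← ∈num⁻ n i∈n
    let u≈ = graph-functional p n (∈-respˡ (graphUpTo p n) (⟪⟫-cong i≈m (≈-refl {x = u})) i,u∈)
    ∈-respˡ (graphUpTo p n) (≈-sym (step-cong p i≈m u≈)) (∈graphUpTo p n (s≤s m<n))

  closed-⊇graph : ∀ {p x g n} → M p → x ≈ num n → Closed p x g →
    ∀ m → m < suc n → ⟪ num m , numName p m ⟫ ∈ g
  closed-⊇graph Mp x≈n (start , step) zero m<1+n = start
  closed-⊇graph {p} {g = g} Mp x≈n (start , step) (suc m) (s≤s m<n) =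
    ∈-respˡ g (step-cong p {n = m} ≈-refl ≈-refl)
      (step _ (M-num m) _ (M-numName Mp m) (∈-respʳ (≈-sym x≈n) (num-< m<n))
        (closed-⊇graph {p} {g = g} Mp x≈n (start , step) m (m<n⇒m<1+n m<n)))

  derivable : ∀ {p x y n} → M p → x ≈ num n → y ≈ numName p n → Derivable p x y
  derivable {n = n} Mp x≈n y≈ g Mg closed =
    ∈-respˡ g (⟪⟫-cong (≈-sym x≈n) (≈-sym y≈)) (closed-⊇graph {g = g} Mp x≈n closed n (n<1+n n))

  -- The finite graph is itself a closed set of `M`, and it is functional.
  derivable-unique : ∀ {p y n} → M p → Derivable p (num n) y → y ≈ numName p n
  derivable-unique {p} {n = n} Mp d =
    graph-functional p n (d (graphUpTo p n) (M-graph Mp n) (graph-closed p n))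

  -- Terms have no constant for `∅`, so it is supplied as a parameter, here `var 5F`.
  ∅ᵗ,∅ᵗ : Term 6
  ∅ᵗ,∅ᵗ = ⟪ var 5F , var 5F ⟫ᵗ

  -- Under the two quantifiers of `closedᶠ`, `var 0F` is `u`, `var 1F` is `i`, and `p` has moved to
  -- `var 6F`.
  i,uᵗ step,stepᵗ : Term 8
  i,uᵗ       = ⟪ var 1F , var 0F ⟫ᵗ
  step,stepᵗ = ⟪ insertᵗ (var 1F) (var 1F) , insertᵗ (var 0F) ⟪ var 0F , var 6F ⟫ᵗ ⟫ᵗ

  x,zᵗ : Term 6
  x,zᵗ = ⟪ var 2F , var 1F ⟫ᵗ

  -- Free variables g, z, x, y, p, ∅.
  closedᶠ : Formula 6
  closedᶠ = ∅ᵗ,∅ᵗ ∈ᶠ 0F ∧̇ ∀̇ ∀̇ (1F ∈̇ 4F ⇒̇ i,uᵗ ∈ᶠ 2F ⇒̇ step,stepᵗ ∈ᶠ 2F)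

  -- Free variables z, x, y, p, ∅.
  derivableᶠ : Formula 5
  derivableᶠ = ∀̇ (closedᶠ ⇒̇ x,zᵗ ∈ᶠ 0F)

  -- y is the only z derivable from x.  Unlike derivability itself, this is
  -- functional for all x in M, as replacement demands.
  numNameᶠ : Formula 4
  numNameᶠ = ∀̇ ((derivableᶠ ⇒̇ 0F ≐ 2F) ∧̇ (0F ≐ 2F ⇒̇ derivableᶠ))

  module _ {p x y z} (Mp : M p) (Mx : M x) (My : M y) (Mz : M z) where

    sat-closed : ∀ {g} → M g → M ⊨ closedᶠ [ g ∷ z ∷ x ∷ y ∷ p ∷ ∅ ∷ [] ] ⇔ Closed p x g
    sat-closed {g} Mg = mk⇔
      (λ (start , step) → to (sat-∈ᶠ ∅ᵗ,∅ᵗ Mρ 0F) start , λ i Mi u Mu i∈x i,u∈g →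
        to (sat-∈ᶠ step,stepᵗ (Mu ∷ Mi ∷ Mρ) 2F)
          (step i Mi u Mu (lift i∈x) (from (sat-∈ᶠ i,uᵗ (Mu ∷ Mi ∷ Mρ) 2F) i,u∈g)))
      (λ (start , step) → from (sat-∈ᶠ ∅ᵗ,∅ᵗ Mρ 0F) start , λ i Mi u Mu i∈x i,u∈g →
        from (sat-∈ᶠ step,stepᵗ (Mu ∷ Mi ∷ Mρ) 2F)
          (step i Mi u Mu (lower i∈x) (to (sat-∈ᶠ i,uᵗ (Mu ∷ Mi ∷ Mρ) 2F) i,u∈g)))
      where
      Mρ : All M (g ∷ z ∷ x ∷ y ∷ p ∷ ∅ ∷ [])
      Mρ = Mg ∷ Mz ∷ Mx ∷ My ∷ Mp ∷ M-∅ ∷ []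

    sat-derivable : M ⊨ derivableᶠ [ z ∷ x ∷ y ∷ p ∷ ∅ ∷ [] ] ⇔ Derivable p x z
    sat-derivable = mk⇔
      (λ h g Mg closed → to (sat-∈ᶠ x,zᵗ (Mρ Mg) 0F) (h g Mg (from (sat-closed Mg) closed)))
      (λ h g Mg closed → from (sat-∈ᶠ x,zᵗ (Mρ Mg) 0F) (h g Mg (to (sat-closed Mg) closed)))
      where
      Mρ : ∀ {g} → M g → All M (g ∷ z ∷ x ∷ y ∷ p ∷ ∅ ∷ [])
      Mρ Mg = Mg ∷ Mz ∷ Mx ∷ My ∷ Mp ∷ M-∅ ∷ []

  -- Replacement on `ω`: at `num n` the unique derivable set is `numName p n`.
  M-numNames : ∀ {p} → M ω → M p → M (numNames p)
  M-numNames {p} Mω Mp = M-ext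
    (do Y , MY , h ← replacement numNameᶠ (p ∷ ∅ ∷ []) (Mp ∷ M-∅ ∷ [])
          -- `y` is derivable because it equals itself, and `z` is the only derivable set.
          (λ x Mx y My z Mz φy φz → lower (proj₁ (φz y My) (from (sat-derivable Mp Mx Mz My)
            (to (sat-derivable Mp Mx My My) (proj₂ (φy y My) (lift ≈-refl))))))
          ω Mω
        return (Y , MY , λ y My → mk⇔
          (λ y∈Y → do
            x , Mx , x∈ω , φ ← to (h y My) y∈Y
            n , x≈n ← ∈ω⁻ x∈ω
            let Mn = M-numName Mp n
            return (lift n , ≈-sym (lower (proj₁ (φ _ Mn)
              (from (sat-derivable Mp Mx My Mn) (derivable Mp x≈n ≈-refl))))))
          (λ y∈ → from (h y My) do
            lift n , y≈ ← y∈
            let Mn = M-num n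
            return (num n , Mn , num∈ω n , λ z Mz →
              (λ d → lift (≈-trans (derivable-unique Mp (to (sat-derivable Mp Mn My Mz) d))
                (≈-sym y≈))) ,
              (λ z≈y → from (sat-derivable Mp Mn My Mz)
                (derivable Mp ≈-refl (≈-trans (lower z≈y) y≈)))))))
    (λ y y∈ → stable y do
      lift n , y≈ ← y∈
      return (M-resp (≈-sym y≈) (M-numName Mp n)))

  -- Any `p` in `G` can tag the names. As a condition it also provides an infinite subset of `ω` in
  -- `M`, from which `ω` is recovered.
  π₁∈extension : ∀ {G} → IsGenericFilter M G → (M [ G ]) π₁
  π₁∈extension {G} isGeneric = do
    p , p∈G ← nonempty
    let Mp , _ , infinite = conditions p p∈G
    D , MD , (D⊆ω , _) , D-infinite ← infinite
    return (π₁Name p , M-⟦⟧ π₁Nameᵗ (M-numNames (M-ω MD D⊆ω D-infinite) Mp ∷ Mp ∷ []) ,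
      π₁≈val G p∈G)
    where open IsGenericFilter isGeneric

corollary29 : ∀ {ℓ c} (V : Pred (𝕍 ℓ) c) (G : 𝕍 ℓ) →
    IsTransitiveModel V → IsGenericFilter V G →
    (∀ A → A ∈ G → ¬ (FiniteToOneOn (V [ G ]) π₁ A ⊎ ConstantOn π₁ A)) ×
    ¬ IsPPoint (V [ G ]) ω² G
corollary29 V G isTransitiveModel isGeneric = not-on , λ isPPoint →
  -- The P-point property applies only to functions in the extension, so `π₁` must first be placed
  -- there.
  π₁∈extension isGeneric λ π₁∈V[G] →
    IsPPoint.pPoint isPPoint π₁ (return π₁∈V[G]) π₁-isFunction λ (A , A∈G , good) →
      good (not-on A A∈G)
  where
  open TransitiveModel isTransitiveModel
  not-on : ∀ A → A ∈ G → ¬ (FiniteToOneOn (V [ G ]) π₁ A ⊎ ConstantOn π₁ A)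
  not-on A A∈G = [ ¬finiteToOne (V [ G ]) A A∈ℙ , ¬constant A A∈ℙ ]′
    where A∈ℙ = IsGenericFilter.conditions isGeneric A A∈G
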